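{- $\mathrm{NID}\notin\Pi_2$.
   Context: Fix a universal prefix-free machine $U$. $K$ denotes prefix-free Kolmogorov complexity and $K(x\mid y)$ conditional prefix-free complexity. For binary strings $x,y$ let $E(x,y)=\max\{K(x\mid y),K(y\mid x)\}$ and $\mathrm{NID}(x,y)=\dfrac{E(x,y)}{\max\{K(x),K(y)\}}$, a rational-valued function on pairs of strings. The oscillation classes: an approximation of $F$ is a computable $f$ with $\lim_{s\to\infty}f(z,s)=F(z)$ for all $z$; $F\in\Sigma_1$ if it has an approximation nondecreasing in $s$; $F\in\Pi_1$ if it has one nonincreasing in $s$; $F\in\Sigma_{n+1}$ if it has a computable approximation $f$ such that for every $z$ there is $s_z$ with $f(z,t)$ nondecreasing for $t<s_z$ and $(f(z,t))_{t\geq s_z}$ a $\Pi_n$-approximation; $F\in\Pi_{n+1}$ likewise with nonincreasing for $t<s_z$ and $(f(z,t))_{t\geq s_z}$ a $\Sigma_n$-approximation. So $\Pi_2$ means an approximation that on each input first goes down (nonincreasing) and then goes up (nondecreasing). -}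

module Defs where

open import Data.Bool.Base using (Bool; true; false)
open import Data.Fin.Base using (Fin)
open import Data.Integer.Base as ℤ using (+_)
open import Data.List.Base using (List; []; _∷_; length)
open import Data.List.Relation.Binary.Prefix.Heterogeneous using (Prefix)
open import Data.Nat.Base using (ℕ; zero; suc; _+_; _*_; _≤_; _<_; _⊔_)
open import Data.Product.Base using (_×_; _,_; ∃; ∃-syntax)
open import Data.Rational.Base as ℚ using (ℚ; 0ℚ; _/_)
open import Data.Vec.Base using (Vec; []; _∷_; lookup)
open import Relation.Binary.PropositionalEquality using (_≡_)

-- Codes for the partial recursive functions ℕⁿ ⇀ ℕ.

data Rec : ℕ → Set where
  zeroᶜ : Rec 0
  sucᶜ  : Rec 1
  proj  : ∀ {n} → Fin n → Rec n
  comp  : ∀ {m n} → Rec m → Vec (Rec n) m → Rec n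
  prec  : ∀ {n} → Rec n → Rec (suc (suc n)) → Rec (suc n)
  min   : ∀ {n} → Rec (suc n) → Rec n

-- c [ xs ]⇓ y : the function coded by c is defined at xs, with value y.

mutual
  infix 4 _[_]⇓_ _[_]⇓*_

  data _[_]⇓_ : ∀ {n} → Rec n → Vec ℕ n → ℕ → Set where
    zero⇓ : zeroᶜ [ [] ]⇓ 0
    suc⇓  : ∀ {x} → sucᶜ [ x ∷ [] ]⇓ suc x
    proj⇓ : ∀ {n} {i : Fin n} {xs} → proj i [ xs ]⇓ lookup xs i
    comp⇓ : ∀ {m n} {f : Rec m} {gs : Vec (Rec n) m} {xs ys z} →
            gs [ xs ]⇓* ys → f [ ys ]⇓ z → comp f gs [ xs ]⇓ z
    prec-zero⇓ : ∀ {n} {g : Rec n} {h xs y} →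
            g [ xs ]⇓ y → prec g h [ 0 ∷ xs ]⇓ y
    prec-suc⇓  : ∀ {n} {g : Rec n} {h k xs r y} →
            prec g h [ k ∷ xs ]⇓ r → h [ k ∷ r ∷ xs ]⇓ y →
            prec g h [ suc k ∷ xs ]⇓ y
    min⇓  : ∀ {n} {f : Rec (suc n)} {xs y} →
            (∀ {z} → z < y → ∃[ v ] f [ z ∷ xs ]⇓ suc v) →
            f [ y ∷ xs ]⇓ 0 → min f [ xs ]⇓ y

  data _[_]⇓*_ {n} : ∀ {m} → Vec (Rec n) m → Vec ℕ n → Vec ℕ m → Set where
    []  : ∀ {xs} → [] [ xs ]⇓* []
    _∷_ : ∀ {m g} {gs : Vec (Rec n) m} {xs y ys} →
          g [ xs ]⇓ y → gs [ xs ]⇓* ys → (g ∷ gs) [ xs ]⇓* (y ∷ ys)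

String : Set
String = List Bool

-- The usual bijection between binary strings and ℕ (length-lexicographic
-- order).

code : String → ℕ
code []          = 0
code (false ∷ x) = 1 + 2 * code x
code (true  ∷ x) = 2 + 2 * code x

-- A machine takes a program and a condition.  As code is a bijection, every
-- partial recursive function of two arguments is a machine.

Machine : Set
Machine = Rec 2

infix 4 _⟨_∣_⟩↦_

_⟨_∣_⟩↦_ : Machine → String → String → String → Set
M ⟨ p ∣ y ⟩↦ x = M [ code p ∷ code y ∷ [] ]⇓ code x

PrefixFree : Machine → Set
PrefixFree M = ∀ {y p q x x′} → M ⟨ p ∣ y ⟩↦ x → M ⟨ q ∣ y ⟩↦ x′ →
               Prefix _≡_ p q → p ≡ q

-- The simulation is only required to cost an additive constant in program
-- length.  Machines that simulate M by prepending to p a fixed string depending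
-- on M are a special case.

record UniversalPrefixFree (U : Machine) : Set where
  field
    prefixFree : PrefixFree U
    simulates  : ∀ M → PrefixFree M →
                 ∃[ c ] (∀ {p y x} → M ⟨ p ∣ y ⟩↦ x →
                         ∃[ q ] (U ⟨ q ∣ y ⟩↦ x × length q ≤ length p + c))

-- K is the conditional complexity of U, K x y being K(x ∣ y).  It is not
-- computable, so it is specified instead of defined; the specification
-- determines it uniquely.

record IsComplexity (U : Machine) (K : String → String → ℕ) : Set where
  field
    attained : ∀ x y → ∃[ p ] (U ⟨ p ∣ y ⟩↦ x × length p ≡ K x y)
    minimal  : ∀ {x y p} → U ⟨ p ∣ y ⟩↦ x → K x y ≤ length p

module _ (K : String → String → ℕ) where

  -- K(x) is K(x ∣ ε), with ε the empty string.

  K₀ : String → ℕ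
  K₀ x = K x []

  E : String → String → ℕ
  E x y = K x y ⊔ K y x

  -- 0 as a quotient by 0 is a dummy value: if K₀ x = 0 then the empty program
  -- halts on condition ε, and for a prefix-free machine no other program does,
  -- so that x would be the only output on condition ε, which universality
  -- excludes.

  NID : String × String → ℚ
  NID (x , y) = E x y over (K₀ x ⊔ K₀ y)
    where
    _over_ : ℕ → ℕ → ℚ
    a over zero  = 0ℚ
    a over suc d = + a / suc d

Inputs : Set
Inputs = String × String

-- A rational is represented by natural numbers a, b, d as (a - b) / (d + 1).

Computable : (Inputs → ℕ → ℚ) → Set
Computable f =
  ∃[ num⁺ ] ∃[ num⁻ ] ∃[ den ] (∀ x y s → let v = code x ∷ code y ∷ s ∷ [] in
    ∃[ a ] ∃[ b ] ∃[ d ] (num⁺ [ v ]⇓ a × num⁻ [ v ]⇓ b × den [ v ]⇓ d ×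
                          f (x , y) s ≡ (a ℤ.⊖ b) / suc d))

Converges : (ℕ → ℚ) → ℚ → Set
Converges g ℓ = ∀ {ε} → 0ℚ ℚ.< ε →
                ∃[ N ] (∀ {s} → N ≤ s → ℚ.∣ g s ℚ.- ℓ ∣ ℚ.< ε)

IsApproximation : (Inputs → ℕ → ℚ) → (Inputs → ℚ) → Set
IsApproximation f F = Computable f × (∀ z → Converges (f z) (F z))

-- The shapes of the sequences f(z, 0), f(z, 1), … for a fixed input z.  Levels
-- start at 1: no sequence has level 0.

mutual
  data ΣShape : ℕ → (ℕ → ℚ) → Set where
    up      : ∀ {g} → (∀ {i j} → i ≤ j → g i ℚ.≤ g j) → ΣShape 1 g
    up-then : ∀ {n g} s → (∀ {i j} → i ≤ j → j < s → g i ℚ.≤ g j) →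
              ΠShape n (λ t → g (s + t)) → ΣShape (suc n) g

  data ΠShape : ℕ → (ℕ → ℚ) → Set where
    down      : ∀ {g} → (∀ {i j} → i ≤ j → g j ℚ.≤ g i) → ΠShape 1 g
    down-then : ∀ {n g} s → (∀ {i j} → i ≤ j → j < s → g j ℚ.≤ g i) →
                ΣShape n (λ t → g (s + t)) → ΠShape (suc n) g

infix 4 _∈Σ_ _∈Π_

_∈Σ_ : (Inputs → ℚ) → ℕ → Set
F ∈Σ n = ∃[ f ] (IsApproximation f F × (∀ z → ΣShape n (f z)))

_∈Π_ : (Inputs → ℚ) → ℕ → Set
F ∈Π n = ∃[ f ] (IsApproximation f F × (∀ z → ΠShape n (f z)))

{-# OPTIONS --safe #-}

-- For suitable h ≪ m consider the pairs x = u + i, y = u + i + r with i < 2ʰ and r < 2ᵐ,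
-- strings being identified with numbers.  If u is random, E(x, y) ≤ m + o(m) is small
-- compared to K(x), so the approximation f(x, y, ·) drops below 1/2.  The first u for
-- which all these values are seen to drop has small complexity; for this u and a random
-- r, E(x, y) ≈ m ≈ max(K(x), K(y)), so that f(x, y, ·) later exceeds 1/2 and can only
-- increase from then on.  The first r for which this is seen for all i again has small
-- complexity, hence E(x, y) is small, while K(x) ≥ h for some i: thus NID(x, y) < 1/2
-- for some x and y for which f has already risen to 1/2.
-- All parameters are linear in k, which exceeds the constants of the simulations.

module Submission where

open import Defs
open import Data.Bool.Base using (true; false)
open import Data.Empty using (⊥; ⊥-elim)
open import Data.Fin using (#_)
open import Data.Fin.Base using (Fin; zero; suc; toℕ; fromℕ<; combine)
open import Data.Fin.Properties using (toℕ<n; fromℕ<-injective; combine-injective; pigeonhole)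
open import Data.Integer.Base as ℤ using (+_; +<+)
open import Data.Integer.Tactic.RingSolver using () renaming (solve-∀ to ℤ-solve-∀)
open import Data.List.Base using ([]; _∷_; length)
open import Data.List.Relation.Binary.Pointwise using (≡⇒Pointwise-≡; Pointwise-≡⇒≡)
open import Data.List.Relation.Binary.Prefix.Heterogeneous using (Prefix; []; _∷_)
open import Data.List.Relation.Binary.Prefix.Heterogeneous.Properties using (fromPointwise; toPointwise)
open import Data.Nat.Base hiding (_/_)
open import Data.Nat.Properties
open import Data.Nat.Tactic.RingSolver using (solve-∀)
open import Data.Product.Base using (_×_; _,_; ∃; ∃-syntax; proj₁; proj₂; Σ-syntax)
open import Data.Rational.Base as ℚ using (ℚ; 0ℚ; _/_; ½)
open import Data.Rational.Unnormalised.Base using (mkℚᵘ; *<*)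
open import Data.Sum.Base using (_⊎_; inj₁; inj₂)
open import Data.Vec.Base using (Vec; []; _∷_; lookup; tabulate; head; tail)
open import Data.Vec.Properties using (tabulate∘lookup)
open import Function.Base using (_∘_; id)
open import Relation.Binary.Definitions using (tri<; tri≈; tri>)
open import Relation.Binary.PropositionalEquality
open import Relation.Nullary.Decidable.Core using (yes; no; map′; decidable-stable)
open import Relation.Nullary.Negation.Core using (¬_)
open import Relation.Unary using (Decidable)
import Data.Integer.Properties as ℤ
import Data.Rational.Properties as ℚ
import Algebra.Properties.Group ℚ.+-0-group as ℚ-group
import Data.Rational.Unnormalised.Properties as ℚᵘ

-- Recursive functions

mutual
  deterministic : ∀ {n} (c : Rec n) {xs y z} → c [ xs ]⇓ y → c [ xs ]⇓ z → y ≡ z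
  deterministic zeroᶜ zero⇓ zero⇓ = refl
  deterministic sucᶜ suc⇓ suc⇓ = refl
  deterministic (proj i) proj⇓ proj⇓ = refl
  deterministic (comp c cs) (comp⇓ ds d) (comp⇓ es e)
    with refl ← deterministic* cs ds es = deterministic c d e
  deterministic (prec g h) (prec-zero⇓ d) (prec-zero⇓ e) = deterministic g d e
  deterministic (prec g h) (prec-suc⇓ d d′) (prec-suc⇓ e e′)
    with refl ← deterministic (prec g h) d e = deterministic h d′ e′
  deterministic (min c) {y = y} {z} (min⇓ ds d) (min⇓ es e) with <-cmp y z
  ... | tri≈ _ y≡z _ = y≡z
  ... | tri< y<z _ _ with () ← deterministic c d (proj₂ (es y<z))
  ... | tri> _ _ z<y with () ← deterministic c e (proj₂ (ds z<y))

  deterministic* : ∀ {n m} (cs : Vec (Rec n) m) {xs ys zs} →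
                   cs [ xs ]⇓* ys → cs [ xs ]⇓* zs → ys ≡ zs
  deterministic* [] [] [] = refl
  deterministic* (c ∷ cs) (d ∷ ds) (e ∷ es) =
    cong₂ _∷_ (deterministic c d e) (deterministic* cs ds es)

Recursive : ∀ {n} → (Vec ℕ n → ℕ) → Set
Recursive {n} f = Σ[ c ∈ Rec n ] (∀ ρ → c [ ρ ]⇓ f ρ)

Recursive* : ∀ {n m} → (Vec ℕ n → Vec ℕ m) → Set
Recursive* {n} {m} F = Σ[ cs ∈ Vec (Rec n) m ] (∀ ρ → cs [ ρ ]⇓* F ρ)

respects : ∀ {n} {f g : Vec ℕ n → ℕ} → f ≗ g → Recursive f → Recursive g
respects f≗g (c , d) = c , λ ρ → subst (c [ ρ ]⇓_) (f≗g ρ) (d ρ)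

infixr 5 _∷ᵣ_

[]ᵣ : ∀ {n} → Recursive* {n} (λ _ → [])
[]ᵣ = [] , λ _ → []

_∷ᵣ_ : ∀ {n m} {f : Vec ℕ n → ℕ} {F : Vec ℕ n → Vec ℕ m} →
       Recursive f → Recursive* F → Recursive* (λ ρ → f ρ ∷ F ρ)
(c , d) ∷ᵣ (cs , ds) = c ∷ cs , λ ρ → d ρ ∷ ds ρ

var : ∀ {n} (i : Fin n) → Recursive (λ ρ → lookup ρ i)
var i = proj i , λ _ → proj⇓

vars : ∀ {n m} (θ : Fin m → Fin n) → Recursive* (λ ρ → tabulate (λ i → lookup ρ (θ i)))
vars {m = zero}  θ = []ᵣ
vars {m = suc m} θ = var (θ zero) ∷ᵣ vars (θ ∘ suc)

idᵣ : ∀ {n} → Recursive* {n} id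
idᵣ with cs , ds ← vars id = cs , λ ρ → subst (cs [ ρ ]⇓*_) (tabulate∘lookup ρ) (ds ρ)

weaken² : ∀ {n} → Recursive* {suc (suc n)} (λ ρ → tail (tail ρ))
weaken² with cs , ds ← vars (λ i → suc (suc i)) =
  cs , λ { (x ∷ y ∷ ρ) →
    subst (cs [ x ∷ y ∷ ρ ]⇓*_) (tabulate∘lookup ρ) (ds (x ∷ y ∷ ρ)) }

_∘ᵣ_ : ∀ {n m} {f : Vec ℕ m → ℕ} {F : Vec ℕ n → Vec ℕ m} →
       Recursive f → Recursive* F → Recursive (λ ρ → f (F ρ))
_∘ᵣ_ {F = F} (c , d) (cs , ds) = comp c cs , λ ρ → comp⇓ (ds ρ) (d (F ρ))

-- The function computed by `prec`: the step receives the counter first and the previous value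
-- second.
iter : ℕ → (ℕ → ℕ → ℕ) → ℕ → ℕ
iter x s zero    = x
iter x s (suc n) = s n (iter x s n)

iterᵣ : ∀ {n} {f : Vec ℕ n → ℕ} {g : Vec ℕ (suc (suc n)) → ℕ} {b : Vec ℕ n → ℕ} →
        Recursive f → Recursive g → Recursive b →
        Recursive (λ ρ → iter (f ρ) (λ z a → g (z ∷ a ∷ ρ)) (b ρ))
iterᵣ {f = f} {g} (c , d) (c′ , d′) b =
  _∘ᵣ_ {f = λ ρ → iter (f (tail ρ)) (λ z a → g (z ∷ a ∷ tail ρ)) (head ρ)}
    (prec c c′ , λ { (n ∷ ρ) → run n ρ }) (b ∷ᵣ idᵣ)
  where
  run : ∀ n ρ → prec c c′ [ n ∷ ρ ]⇓ iter (f ρ) (λ z a → g (z ∷ a ∷ ρ)) n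
  run zero    ρ = prec-zero⇓ (d ρ)
  run (suc n) ρ = prec-suc⇓ (run n ρ) (d′ _)

sucᵣ : ∀ {n} {f : Vec ℕ n → ℕ} → Recursive f → Recursive (λ ρ → suc (f ρ))
sucᵣ {f = f} (c , d) = comp sucᶜ (c ∷ []) , λ ρ → comp⇓ (d ρ ∷ []) suc⇓

lit : ∀ {n} a → Recursive {n} (λ _ → a)
lit zero    = comp zeroᶜ [] , λ _ → comp⇓ [] zero⇓
lit (suc a) = sucᵣ (lit a)

infixl 6 _+ᵣ_ _∸ᵣ_
infixl 7 _*ᵣ_

_+ᵣ_ : ∀ {n} {f g : Vec ℕ n → ℕ} → Recursive f → Recursive g → Recursive (λ ρ → f ρ + g ρ)
_+ᵣ_ {f = f} {g} f-rec g-rec = respects (λ ρ → iter-suc (f ρ) (g ρ))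
  (iterᵣ g-rec (sucᵣ (var (# 1))) f-rec)
  where
  iter-suc : ∀ x y → iter y (λ _ → suc) x ≡ x + y
  iter-suc zero    y = refl
  iter-suc (suc x) y = cong suc (iter-suc x y)

_∸ᵣ_ : ∀ {n} {f g : Vec ℕ n → ℕ} → Recursive f → Recursive g → Recursive (λ ρ → f ρ ∸ g ρ)
_∸ᵣ_ {f = f} {g} f-rec g-rec = respects (λ ρ → iter-pred (f ρ) (g ρ))
  -- The predecessor is a primitive recursion whose step returns its counter.
  (iterᵣ f-rec (iterᵣ (lit 0) (var (# 0)) (var (# 1))) g-rec)
  where
  predecessor : ℕ → ℕ
  predecessor = iter 0 (λ z _ → z)

  predecessor≗pred : predecessor ≗ pred
  predecessor≗pred zero    = refl
  predecessor≗pred (suc x) = refl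

  iter-pred : ∀ x y → iter x (λ _ → predecessor) y ≡ x ∸ y
  iter-pred x zero    = refl
  iter-pred x (suc y) = trans (predecessor≗pred (iter x (λ _ → predecessor) y))
    (trans (cong pred (iter-pred x y)) (pred[m∸n]≡m∸[1+n] x y))

_*ᵣ_ : ∀ {n} {f g : Vec ℕ n → ℕ} → Recursive f → Recursive g → Recursive (λ ρ → f ρ * g ρ)
_*ᵣ_ {f = f} {g} f-rec g-rec = respects (λ ρ → iter-+ (f ρ) (g ρ))
  (iterᵣ (lit 0) ((g-rec ∘ᵣ weaken²) +ᵣ var (# 1)) f-rec)
  where
  iter-+ : ∀ x y → iter 0 (λ _ a → y + a) x ≡ x * y
  iter-+ zero    y = refl
  iter-+ (suc x) y = cong (λ a → y + a) (iter-+ x y)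

2^ᵣ_ : ∀ {n} {f : Vec ℕ n → ℕ} → Recursive f → Recursive (λ ρ → 2 ^ f ρ)
2^ᵣ_ {f = f} f-rec = respects (λ ρ → iter-double (f ρ))
  (iterᵣ (lit 1) (lit 2 *ᵣ var (# 1)) f-rec)
  where
  iter-double : ∀ x → iter 1 (λ _ → 2 *_) x ≡ 2 ^ x
  iter-double zero    = refl
  iter-double (suc x) = cong (2 *_) (iter-double x)

-- Recursive predicates

-- Truth is encoded as the value 0, since `min` searches for a zero.
record RecursivePred {n} (P : Vec ℕ n → Set) : Set where
  field
    {char}   : Vec ℕ n → ℕ
    char-rec : Recursive char
    sound    : ∀ ρ → char ρ ≡ 0 → P ρ
    complete : ∀ ρ → P ρ → char ρ ≡ 0

  decide : Decidable P
  decide ρ = map′ (sound ρ) (complete ρ) (char ρ ≟ 0)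

open RecursivePred

_∘ₚ_ : ∀ {n m} {P : Vec ℕ m → Set} {F : Vec ℕ n → Vec ℕ m} →
       RecursivePred P → Recursive* F → RecursivePred (λ ρ → P (F ρ))
_∘ₚ_ {F = F} P F-rec = record
  { char-rec = char-rec P ∘ᵣ F-rec
  ; sound    = λ ρ → sound P (F ρ)
  ; complete = λ ρ → complete P (F ρ)
  }

_<ₚ_ : ∀ {n} {f g : Vec ℕ n → ℕ} → Recursive f → Recursive g →
       RecursivePred (λ ρ → f ρ < g ρ)
f <ₚ g = record
  { char-rec = sucᵣ f ∸ᵣ g
  ; sound    = λ ρ → m∸n≡0⇒m≤n
  ; complete = λ ρ → m≤n⇒m∸n≡0
  }

_≡ₚ_ : ∀ {n} {f g : Vec ℕ n → ℕ} → Recursive f → Recursive g →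
       RecursivePred (λ ρ → f ρ ≡ g ρ)
_≡ₚ_ {f = f} {g} f-rec g-rec = record
  { char-rec = (f-rec ∸ᵣ g-rec) +ᵣ (g-rec ∸ᵣ f-rec)
  ; sound    = λ ρ eq → ≤-antisym
      (m∸n≡0⇒m≤n (m+n≡0⇒m≡0 (f ρ ∸ g ρ) eq))
      (m∸n≡0⇒m≤n (m+n≡0⇒n≡0 (f ρ ∸ g ρ) eq))
  ; complete = λ ρ eq → cong₂ _+_
      (m≤n⇒m∸n≡0 (≤-reflexive eq)) (m≤n⇒m∸n≡0 (≤-reflexive (sym eq)))
  }

¬ₚ_ : ∀ {n} {P : Vec ℕ n → Set} → RecursivePred P → RecursivePred (λ ρ → ¬ P ρ)
¬ₚ P = record
  { char-rec = lit 1 ∸ᵣ char-rec P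
  ; sound    = λ ρ eq p → case-zero (complete P ρ p) eq
  ; complete = λ ρ ¬p → case-suc (λ eq → ¬p (sound P ρ eq))
  }
  where
  case-zero : ∀ {x} → x ≡ 0 → 1 ∸ x ≢ 0
  case-zero refl ()

  case-suc : ∀ {x} → x ≢ 0 → 1 ∸ x ≡ 0
  case-suc {zero}  x≢0 = ⊥-elim (x≢0 refl)
  case-suc {suc x} _   = 0∸n≡0 x

_×ₚ_ : ∀ {n} {P Q : Vec ℕ n → Set} → RecursivePred P → RecursivePred Q →
       RecursivePred (λ ρ → P ρ × Q ρ)
P ×ₚ Q = record
  { char-rec = char-rec P +ᵣ char-rec Q
  ; sound    = λ ρ eq → sound P ρ (m+n≡0⇒m≡0 _ eq) , sound Q ρ (m+n≡0⇒n≡0 (char P ρ) eq)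
  ; complete = λ { ρ (p , q) → cong₂ _+_ (complete P ρ p) (complete Q ρ q) }
  }

_⊎ₚ_ : ∀ {n} {P Q : Vec ℕ n → Set} → RecursivePred P → RecursivePred Q →
       RecursivePred (λ ρ → P ρ ⊎ Q ρ)
_⊎ₚ_ {P = P′} {Q′} P Q = record
  { char-rec = char-rec P *ᵣ char-rec Q
  ; sound    = λ ρ eq → split ρ (m*n≡0⇒m≡0∨n≡0 (char P ρ) eq)
  ; complete = λ { ρ (inj₁ p) → cong (_* char Q ρ) (complete P ρ p)
                 ; ρ (inj₂ q) → trans (cong (char P ρ *_) (complete Q ρ q)) (*-zeroʳ (char P ρ)) }
  }
  where
  split : ∀ ρ → char P ρ ≡ 0 ⊎ char Q ρ ≡ 0 → P′ ρ ⊎ Q′ ρ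
  split ρ (inj₁ eq) = inj₁ (sound P ρ eq)
  split ρ (inj₂ eq) = inj₂ (sound Q ρ eq)

∃< : ∀ {n} {b : Vec ℕ n → ℕ} {P : Vec ℕ (suc n) → Set} → Recursive b → RecursivePred P →
     RecursivePred (λ ρ → ∃[ z ] (z < b ρ × P (z ∷ ρ)))
∃< {b = b} {P = P′} b-rec P = record
  -- A product over all `z` below the bound vanishes exactly if some factor does.
  { char-rec = iterᵣ (lit 1) ((char-rec P ∘ᵣ (var (# 0) ∷ᵣ weaken²)) *ᵣ var (# 1)) b-rec
  ; sound    = λ ρ → to ρ (b ρ)
  ; complete = λ { ρ (z , z<b , p) → from ρ (b ρ) z<b (complete P (z ∷ ρ) p) }
  }
  where
  product : Vec ℕ _ → ℕ → ℕ
  product ρ = iter 1 (λ z a → char P (z ∷ ρ) * a)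

  to : ∀ ρ n → product ρ n ≡ 0 → ∃[ z ] (z < n × P′ (z ∷ ρ))
  to ρ (suc n) eq with m*n≡0⇒m≡0∨n≡0 (char P (n ∷ ρ)) eq
  ... | inj₁ eq′ = n , n<1+n n , sound P (n ∷ ρ) eq′
  ... | inj₂ eq′ with z , z<n , p ← to ρ n eq′ = z , m<n⇒m<1+n z<n , p

  from : ∀ ρ n {z} → z < n → char P (z ∷ ρ) ≡ 0 → product ρ n ≡ 0
  from ρ (suc n) {z} z<1+n eq with z ≟ n
  ... | yes refl = cong (_* product ρ n) eq
  ... | no  z≢n  = trans
    (cong (char P (n ∷ ρ) *_) (from ρ n (≤∧≢⇒< (s≤s⁻¹ z<1+n) z≢n) eq))
    (*-zeroʳ (char P (n ∷ ρ)))

-- De Morgan from `∃<`; the double negation can be removed because `P` is decidable.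
∀< : ∀ {n} {b : Vec ℕ n → ℕ} {P : Vec ℕ (suc n) → Set} → Recursive b → RecursivePred P →
     RecursivePred (λ ρ → ∀ z → z < b ρ → P (z ∷ ρ))
∀< b-rec P = record
  { char-rec = char-rec none
  ; sound    = λ ρ eq z z<b → decidable-stable (decide P (z ∷ ρ))
                 (λ ¬p → sound none ρ eq (z , z<b , ¬p))
  ; complete = λ ρ all → complete none ρ λ { (z , z<b , ¬p) → ¬p (all z z<b) }
  }
  where
  none = ¬ₚ ∃< b-rec (¬ₚ P)

-- Unbounded search

minimum : ∀ {P : ℕ → Set} → Decidable P → ∀ {n} → P n →
          ∃[ y ] (P y × (∀ {z} → z < y → ¬ P z))
minimum {P} P? {n} p with below (suc n)
  where
  below : ∀ n → (∃[ y ] (P y × (∀ {z} → z < y → ¬ P z))) ⊎ (∀ {z} → z < n → ¬ P z)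
  below zero = inj₂ λ ()
  below (suc n) with below n
  ... | inj₁ found = inj₁ found
  ... | inj₂ none with P? n
  ...   | yes q = inj₁ (n , q , none)
  ...   | no ¬q = inj₂ λ z<1+n q → none (≤∧≢⇒< (s≤s⁻¹ z<1+n) λ { refl → ¬q q }) q
... | inj₁ found = found
... | inj₂ none  = ⊥-elim (none (n<1+n n) p)

module _ {n} {P : Vec ℕ (suc n) → Set} (P-rec : RecursivePred P) where

  μ : Rec n
  μ = min (proj₁ (char-rec P-rec))

  μ-sound : ∀ {ρ y} → μ [ ρ ]⇓ y → P (y ∷ ρ)
  μ-sound {ρ} {y} (min⇓ _ d) = sound P-rec (y ∷ ρ)
    (deterministic (proj₁ (char-rec P-rec)) (proj₂ (char-rec P-rec) (y ∷ ρ)) d)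

  μ-complete : ∀ {ρ y} → P (y ∷ ρ) → (∀ {z} → z < y → ¬ P (z ∷ ρ)) → μ [ ρ ]⇓ y
  μ-complete {ρ} {y} p least = min⇓
    (λ {z} z<y → positive (λ eq → least z<y (sound P-rec (z ∷ ρ) eq))
                          (proj₂ (char-rec P-rec) (z ∷ ρ)))
    (subst (_ [ y ∷ ρ ]⇓_) (complete P-rec (y ∷ ρ) p) (proj₂ (char-rec P-rec) (y ∷ ρ)))
    where
    positive : ∀ {c : Rec (suc n)} {xs x} → x ≢ 0 → c [ xs ]⇓ x → ∃[ v ] c [ xs ]⇓ suc v
    positive {x = zero}  x≢0 _ = ⊥-elim (x≢0 refl)
    positive {x = suc v} _   d = v , d

  search : (∀ ρ → ∃[ z ] P (z ∷ ρ)) →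
           ∃[ f ] (Recursive f × (∀ ρ → P (f ρ ∷ ρ)))
  search total = (λ ρ → proj₁ (least ρ)) ,
    (μ , λ ρ → μ-complete (proj₁ (proj₂ (least ρ))) (proj₂ (proj₂ (least ρ)))) ,
    λ ρ → proj₁ (proj₂ (least ρ))
    where
    least : ∀ ρ → _
    least ρ = minimum (λ z → decide P-rec (z ∷ ρ)) (proj₂ (total ρ))

-- Dovetailing in two stages: a common bound `b` for `a` and `t` is found first, then `a` is
-- searched for with `t` bounded by `b`, which keeps the condition decidable. Below `k₀`, where no
-- solution is promised, both searches succeed trivially, so that `f` is total.
search² : ∀ {P : Vec ℕ 3 → Set} → RecursivePred P → ∀ k₀ →
          (∀ k → k₀ ≤ k → ∃[ a ] ∃[ t ] P (a ∷ t ∷ k ∷ [])) →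
          ∃[ f ] (Recursive f × (∀ k → k₀ ≤ k → ∃[ t ] P (f (k ∷ []) ∷ t ∷ k ∷ [])))
search² {P} P-rec k₀ exists = f , f-rec , λ k k₀≤k → extract k₀≤k (f-spec (k ∷ []))
  where
  bounded : ∃[ b ] (Recursive b × (∀ (ρ : Vec ℕ 1) → lookup ρ (# 0) < k₀ ⊎
              (∃[ a ] (a < b ρ × (∃[ t ] (t < b ρ × P (a ∷ t ∷ lookup ρ (# 0) ∷ [])))))))
  bounded = search
    ((var (# 1) <ₚ lit k₀) ⊎ₚ
     ∃< (var (# 0)) (∃< (var (# 1))
       (P-rec ∘ₚ (var (# 1) ∷ᵣ var (# 0) ∷ᵣ var (# 3) ∷ᵣ []ᵣ))))
    total
    where
    total : ∀ (ρ : Vec ℕ 1) → ∃[ z ] (lookup ρ (# 0) < k₀ ⊎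
              (∃[ a ] (a < z × (∃[ t ] (t < z × P (a ∷ t ∷ lookup ρ (# 0) ∷ []))))))
    total (k ∷ []) with k <? k₀
    ... | yes k<k₀ = 0 , inj₁ k<k₀
    ... | no  k≮k₀ with a , t , p ← exists k (≮⇒≥ k≮k₀) =
      suc (a ⊔ t) , inj₂ (a , s≤s (m≤m⊔n a t) , t , s≤s (m≤n⊔m a t) , p)
  b = proj₁ bounded

  selected : ∃[ f ] (Recursive f × (∀ (ρ : Vec ℕ 1) → lookup ρ (# 0) < k₀ ⊎
               (∃[ t ] (t < b (lookup ρ (# 0) ∷ []) × P (f ρ ∷ t ∷ lookup ρ (# 0) ∷ [])))))
  selected = search
    ((var (# 1) <ₚ lit k₀) ⊎ₚ
     ∃< (proj₁ (proj₂ bounded) ∘ᵣ (var (# 1) ∷ᵣ []ᵣ))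
       (P-rec ∘ₚ (var (# 1) ∷ᵣ var (# 0) ∷ᵣ var (# 2) ∷ᵣ []ᵣ)))
    total
    where
    total : ∀ (ρ : Vec ℕ 1) → ∃[ a ] (lookup ρ (# 0) < k₀ ⊎
               (∃[ t ] (t < b (lookup ρ (# 0) ∷ []) × P (a ∷ t ∷ lookup ρ (# 0) ∷ []))))
    total (k ∷ []) with proj₂ (proj₂ bounded) (k ∷ [])
    ... | inj₁ k<k₀ = 0 , inj₁ k<k₀
    ... | inj₂ (a , _ , t , t<b , p) = a , inj₂ (t , t<b , p)
  f = proj₁ selected
  f-rec = proj₁ (proj₂ selected)
  f-spec = proj₂ (proj₂ selected)

  extract : ∀ {k} {a t : ℕ → Set} → k₀ ≤ k → k < k₀ ⊎ (∃[ x ] (a x × t x)) → ∃ t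
  extract k₀≤k (inj₁ k<k₀)        = ⊥-elim (<⇒≱ k<k₀ k₀≤k)
  extract k₀≤k (inj₂ (x , _ , q)) = x , q

-- Strings and numbers

-- Successor in bijective base two, least significant digit first; iterating it inverts `code`.
increment : String → String
increment []          = false ∷ []
increment (false ∷ x) = true ∷ x
increment (true  ∷ x) = false ∷ increment x

code-increment : ∀ x → code (increment x) ≡ suc (code x)
code-increment []          = refl
code-increment (false ∷ x) = refl
code-increment (true  ∷ x) = cong suc (trans (cong (2 *_) (code-increment x)) (*-suc 2 (code x)))

decode : ℕ → String
decode zero    = []
decode (suc n) = increment (decode n)

code-decode : ∀ n → code (decode n) ≡ n
code-decode zero    = refl
code-decode (suc n) = trans (code-increment (decode n)) (cong suc (code-decode n))

code-injective : ∀ {x y} → code x ≡ code y → x ≡ y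
code-injective {[]}        {[]}        eq = refl
code-injective {[]}        {false ∷ y} ()
code-injective {[]}        {true ∷ y}  ()
code-injective {false ∷ x} {[]}        ()
code-injective {true ∷ x}  {[]}        ()
code-injective {false ∷ x} {false ∷ y} eq =
  cong (false ∷_) (code-injective (*-cancelˡ-≡ _ _ 2 (suc-injective eq)))
code-injective {true ∷ x}  {true ∷ y}  eq =
  cong (true ∷_) (code-injective (*-cancelˡ-≡ _ _ 2 (suc-injective (suc-injective eq))))
code-injective {false ∷ x} {true ∷ y}  eq =
  ⊥-elim (even≢odd (code x) (code y) (suc-injective eq))
code-injective {true ∷ x}  {false ∷ y} eq =
  ⊥-elim (even≢odd (code y) (code x) (suc-injective (sym eq)))

decode-injective : ∀ {m n} → decode m ≡ decode n → m ≡ n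
decode-injective {m} {n} eq = trans (sym (code-decode m)) (trans (cong code eq) (code-decode n))

-- With `1+code<2^1+length` this locates the strings of each length: `suc (code x)` runs from
-- `2 ^ length x` up to, but excluding, the next power of 2.
2^length≤1+code : ∀ x → 2 ^ length x ≤ suc (code x)
2^length≤1+code []          = ≤-refl
2^length≤1+code (false ∷ x) = ≤-trans (*-monoʳ-≤ 2 (2^length≤1+code x)) (≤-reflexive (*-suc 2 (code x)))
2^length≤1+code (true ∷ x)  =
  m≤n⇒m≤1+n (≤-trans (*-monoʳ-≤ 2 (2^length≤1+code x)) (≤-reflexive (*-suc 2 (code x))))

2*[2+n]≡2+[2+2*n] : ∀ n → 2 * (2 + n) ≡ 2 + (2 + 2 * n)
2*[2+n]≡2+[2+2*n] n = trans (*-suc 2 (suc n)) (cong (λ a → 2 + a) (*-suc 2 n))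

1+code<2^1+length : ∀ x → suc (code x) < 2 ^ suc (length x)
1+code<2^1+length []      = ≤-refl
1+code<2^1+length (b ∷ x) = ≤-trans (s≤s (s≤s (code-∷ b)))
  (≤-trans (≤-reflexive (sym (2*[2+n]≡2+[2+2*n] (code x)))) (*-monoʳ-≤ 2 (1+code<2^1+length x)))
  where
  code-∷ : ∀ b → code (b ∷ x) ≤ 2 + 2 * code x
  code-∷ false = n≤1+n _
  code-∷ true  = ≤-refl

2^-cancel-< : ∀ {m n} → 2 ^ m < 2 ^ n → m < n
2^-cancel-< 2^m<2^n = ≰⇒> λ n≤m → <⇒≱ 2^m<2^n (^-monoʳ-≤ 2 n≤m)

-- Self-delimiting programs

payload : ∀ ℓ {v} → v < 2 ^ ℓ → ∃[ w ] (length w ≡ ℓ × suc (code w) ≡ 2 ^ ℓ + v)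
payload ℓ {v} v<2^ℓ = w , length-w , code-w
  where
  instance _ = m^n≢0 2 ℓ
  w = decode (pred (2 ^ ℓ) + v)

  code-w : suc (code w) ≡ 2 ^ ℓ + v
  code-w = trans (cong suc (code-decode (pred (2 ^ ℓ) + v))) (cong (_+ v) (suc-pred (2 ^ ℓ)))

  length-w : length w ≡ ℓ
  length-w = ≤-antisym
    (s≤s⁻¹ (2^-cancel-< (≤-<-trans (2^length≤1+code w) (subst₂ _<_ (sym code-w)
      (cong (λ a → 2 ^ ℓ + a) (sym (+-identityʳ (2 ^ ℓ)))) (+-monoʳ-< (2 ^ ℓ) v<2^ℓ)))))
    (s≤s⁻¹ (2^-cancel-< (≤-<-trans (m≤m+n (2 ^ ℓ) v)
      (subst (_< 2 ^ suc (length w)) code-w (1+code<2^1+length w)))))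

delimit : ℕ → String → String
delimit zero    w = false ∷ w
delimit (suc k) w = true ∷ delimit k w

length-delimit : ∀ k w → length (delimit k w) ≡ suc (k + length w)
length-delimit zero    w = refl
length-delimit (suc k) w = cong suc (length-delimit k w)

-- Prepending `true` doubles `2 + code`. This turns the shape of a program into an arithmetic
-- equation, which a recursive predicate can test.
code-delimit : ∀ k w → 2 + code (delimit k w) ≡ 2 ^ k * (1 + 2 * suc (code w))
code-delimit zero    w = trans (cong suc (sym (*-suc 2 (code w)))) (sym (*-identityˡ _))
code-delimit (suc k) w = trans (sym (2*[2+n]≡2+[2+2*n] (code (delimit k w))))
  (trans (cong (2 *_) (code-delimit k w)) (sym (*-assoc 2 (2 ^ k) _)))

delimit-prefix : ∀ k k′ {w w′} → Prefix _≡_ (delimit k w) (delimit k′ w′) →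
                 k ≡ k′ × Prefix _≡_ w w′
delimit-prefix zero    zero     (_ ∷ w≤w′) = refl , w≤w′
delimit-prefix zero    (suc k′) (() ∷ _)
delimit-prefix (suc k) zero     (() ∷ _)
delimit-prefix (suc k) (suc k′) (_ ∷ p) with k≡k′ , w≤w′ ← delimit-prefix k k′ p =
  cong suc k≡k′ , w≤w′

prefix-refl : ∀ (x : String) → Prefix _≡_ x x
prefix-refl x = fromPointwise (≡⇒Pointwise-≡ refl)

-- The programs of the machine are the strings 1ᵏ0w with ∣ w ∣ = ℓ k, where w stands for
-- v = 1 + code w - 2 ^ ℓ k; it then computes F(k, v, y).

module SelfDelimiting
  {F : Vec ℕ 3 → ℕ} (F-rec : Recursive F) {ℓ : Vec ℕ 1 → ℕ} (ℓ-rec : Recursive ℓ) where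

  -- The equation of `code-delimit`, with `suc (code w)` replaced by its value from `payload`.
  Parses : ℕ → ℕ → ℕ → Set
  Parses k v p = 2 + p ≡ 2 ^ k * (1 + 2 * (2 ^ ℓ (k ∷ []) + v))

  abstract
    parsesᵣ : ∀ {n} {k v p : Vec ℕ n → ℕ} → Recursive k → Recursive v → Recursive p →
              RecursivePred (λ ρ → Parses (k ρ) (v ρ) (p ρ))
    parsesᵣ k v p =
      sucᵣ (sucᵣ p) ≡ₚ ((2^ᵣ k) *ᵣ sucᵣ (lit 2 *ᵣ ((2^ᵣ (ℓ-rec ∘ᵣ (k ∷ᵣ []ᵣ))) +ᵣ v)))

    headerᵣ : RecursivePred {3} (λ ρ → ∃[ v ] (v < 2 ^ ℓ (lookup ρ (# 0) ∷ []) ×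
                Parses (lookup ρ (# 0)) v (lookup ρ (# 1))))
    headerᵣ = ∃< (2^ᵣ (ℓ-rec ∘ᵣ (var (# 0) ∷ᵣ []ᵣ)))
                 (parsesᵣ (var (# 1)) (var (# 0)) (var (# 2)))

    payloadᵣ : RecursivePred {4} (λ ρ → Parses (lookup ρ (# 1)) (lookup ρ (# 0))
                 (lookup ρ (# 2)))
    payloadᵣ = parsesᵣ (var (# 1)) (var (# 0)) (var (# 2))

  machine : Machine
  -- The header `k` is found first, then the payload from `k` and the program. On a string that is
  -- no program the search for `k` diverges.
  machine = comp (comp (proj₁ F-rec) (proj (# 0) ∷ μ payloadᵣ ∷ proj (# 2) ∷ []))
                 (μ headerᵣ ∷ proj (# 0) ∷ proj (# 1) ∷ [])

  parse-delimit : ∀ {k v p} → v < 2 ^ ℓ (k ∷ []) → Parses k v (code p) →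
                  ∃[ w ] (length w ≡ ℓ (k ∷ []) × suc (code w) ≡ 2 ^ ℓ (k ∷ []) + v × p ≡ delimit k w)
  parse-delimit {k} v<2^ℓ parses with w , length-w , code-w ← payload (ℓ (k ∷ [])) v<2^ℓ =
    w , length-w , code-w , code-injective (+-cancelˡ-≡ 2 _ _ (trans parses
      (sym (trans (code-delimit k w) (cong (λ c → 2 ^ k * (1 + 2 * c)) code-w)))))

  program : ∀ {p y x} → machine ⟨ p ∣ y ⟩↦ x →
            ∃[ k ] ∃[ w ] (length w ≡ ℓ (k ∷ []) × p ≡ delimit k w)
  program (comp⇓ (dk ∷ _) _) with v , v<2^ℓ , parses ← μ-sound headerᵣ dk
    with w , length-w , _ , p≡ ← parse-delimit v<2^ℓ parses = _ , w , length-w , p≡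

  -- The first `false` ends the header, so comparable programs have the same `k`; their payloads
  -- then have the same length `ℓ (k ∷ [])`, and a prefix of equal length is equal.
  prefixFree : PrefixFree machine
  prefixFree {y} {p} {q} {x} {x′} p↦ q↦ p≤q
    with k  , w  , length-w  , refl ← program {p} {y} {x}  p↦
       | k′ , w′ , length-w′ , refl ← program {q} {y} {x′} q↦
    with refl , w≤w′ ← delimit-prefix k k′ p≤q =
    cong (delimit k)
      (Pointwise-≡⇒≡ (toPointwise (trans length-w (sym length-w′)) w≤w′))

  -- Parsing is unique, so the two searches stop at the intended `k` and `v`.
  runs : ∀ k {v y x} → v < 2 ^ ℓ (k ∷ []) → code x ≡ F (k ∷ v ∷ code y ∷ []) →
         ∃[ p ] (machine ⟨ p ∣ y ⟩↦ x × length p ≡ suc (k + ℓ (k ∷ [])))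
  runs k {v} {y} {x} v<2^ℓ x≡ with w , length-w , code-w ← payload (ℓ (k ∷ [])) v<2^ℓ =
    p , subst (machine [ code p ∷ code y ∷ [] ]⇓_) (sym x≡) halts ,
    trans (length-delimit k w) (cong (λ l → suc (k + l)) length-w)
    where
    p = delimit k w

    parses : Parses k v (code p)
    parses = trans (code-delimit k w) (cong (λ c → 2 ^ k * (1 + 2 * c)) code-w)

    header-unique : ∀ {k′ v′} → v′ < 2 ^ ℓ (k′ ∷ []) → Parses k′ v′ (code p) → k′ ≡ k
    header-unique {k′} v′< parses′ with w′ , _ , _ , p≡ ← parse-delimit v′< parses′ =
      sym (proj₁ (delimit-prefix k k′ (subst (Prefix _≡_ p) p≡ (prefix-refl p))))

    payload-unique : ∀ {v′} → Parses k v′ (code p) → v′ ≡ v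
    payload-unique {v′} parses′ = +-cancelˡ-≡ (2 ^ ℓ (k ∷ [])) _ _
      (*-cancelˡ-≡ _ _ 2 (suc-injective
        (*-cancelˡ-≡ _ _ (2 ^ k) {{m^n≢0 2 k}} (trans (sym parses′) parses))))

    halts : machine [ code p ∷ code y ∷ [] ]⇓ F (k ∷ v ∷ code y ∷ [])
    halts = comp⇓
      (μ-complete headerᵣ (v , v<2^ℓ , parses)
         (λ { k′<k (_ , v′< , parses′) → <⇒≢ k′<k (header-unique v′< parses′) })
       ∷ proj⇓ ∷ proj⇓ ∷ [])
      (comp⇓
        (proj⇓ ∷ μ-complete payloadᵣ parses (λ v′<v parses′ → <⇒≢ v′<v (payload-unique parses′))
         ∷ proj⇓ ∷ [])
        (proj₂ F-rec _))

-- Bounds on complexity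

module Bounds
  {U : Machine} (universal : UniversalPrefixFree U)
  {K : String → String → ℕ} (complexity : IsComplexity U K) where

  open UniversalPrefixFree universal
  open IsComplexity complexity

  κ : ℕ → ℕ → ℕ
  κ a b = K (decode a) (decode b)

  -- The constant depends on `F` and `ℓ` only. As both may use `k`, whatever is computable from `k`
  -- costs no more than the header, and a large `k` outweighs `c`.
  κ-upper : ∀ {F : Vec ℕ 3 → ℕ} → Recursive F → ∀ {ℓ : Vec ℕ 1 → ℕ} → Recursive ℓ →
            ∃[ c ] (∀ k v b → v < 2 ^ ℓ (k ∷ []) →
                    κ (F (k ∷ v ∷ b ∷ [])) b ≤ suc (k + ℓ (k ∷ [])) + c)
  κ-upper {F} F-rec {ℓ} ℓ-rec = c , bound
    where
    module M = SelfDelimiting F-rec ℓ-rec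

    simulation = simulates M.machine
      λ {y} {p} {q} {x} {x′} → M.prefixFree {y} {p} {q} {x} {x′}
    c = proj₁ simulation

    bound : ∀ k v b → v < 2 ^ ℓ (k ∷ []) →
            κ (F (k ∷ v ∷ b ∷ [])) b ≤ suc (k + ℓ (k ∷ [])) + c
    bound k v b v<2^ℓ
      with p , p↦ , length-p ← M.runs k {y = decode b} {x = decode (F (k ∷ v ∷ b ∷ []))} v<2^ℓ
             (trans (code-decode _) (cong (λ b → F (k ∷ v ∷ b ∷ [])) (sym (code-decode b))))
      with q , q↦ , length-q ← proj₂ simulation {p} {decode b} {decode (F (k ∷ v ∷ b ∷ []))} p↦ =
      ≤-trans (minimal {decode (F (k ∷ v ∷ b ∷ []))} {decode b} {q} q↦)
        (subst (λ l → length q ≤ l + c) length-p length-q)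

  output-unique : ∀ {p x x′ y} → U ⟨ p ∣ y ⟩↦ x → U ⟨ p ∣ y ⟩↦ x′ → x ≡ x′
  output-unique p↦x p↦x′ = code-injective (deterministic U p↦x p↦x′)

  -- Otherwise a pair of some i and a program shorter than L would determine r, but
  -- there are fewer than 2 ^ (h + L) such pairs.
  κ-lower : ∀ h L (w : ℕ → ℕ → ℕ) (c : ℕ → ℕ) → (∀ i {r r′} → w i r ≡ w i r′ → r ≡ r′) →
            ∃[ r ] (r < 2 ^ (h + L) × (∀ {i} → i < 2 ^ h → L ≤ κ (w i r) (c i)))
  κ-lower h L w c w-injective
    with anyUpTo? (λ r → allUpTo? (λ i → L ≤? κ (w i r) (c i)) (2 ^ h)) (2 ^ (h + L))
  ... | yes found = found
  ... | no  none  = ⊥-elim absurd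
    where
    instance
      2^h≢0 = m^n≢0 2 h
      2^L≢0 = m^n≢0 2 L

    bad : ∀ {r} → r < 2 ^ (h + L) → ∃[ i ] (i < 2 ^ h × κ (w i r) (c i) < L)
    bad {r} r< with anyUpTo? (λ i → κ (w i r) (c i) <? L) (2 ^ h)
    ... | yes found = found
    ... | no  none′ = ⊥-elim (none (r , r< , λ i< → ≮⇒≥ (λ κ<L → none′ (_ , i< , κ<L))))

    -- The strings of length below `L` are those with code below `2 ^ L - 1`. That this is less than
    -- `2 ^ L` makes the count of pairs strictly too small.
    Short : ℕ → Set
    Short r = ∃[ i ] ∃[ p ] (i < 2 ^ h × code p < pred (2 ^ L) ×
                             U ⟨ p ∣ decode (c i) ⟩↦ decode (w i r))

    short : ∀ {r} → r < 2 ^ (h + L) → Short r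
    short {r} r< with i , i< , κ<L ← bad r<
      with p , p↦ , length-p ← attained (decode (w i r)) (decode (c i)) =
      i , p , i< , s≤s⁻¹ (≤-trans (1+code<2^1+length p)
        (≤-trans (^-monoʳ-≤ 2 (subst (_< L) (sym length-p) κ<L)) (≤-reflexive (sym (suc-pred (2 ^ L)))))) , p↦

    label : ∀ {r} → Short r → Fin (2 ^ h * pred (2 ^ L))
    label (_ , _ , i< , p< , _) = combine (fromℕ< i<) (fromℕ< p<)

    label-injective : ∀ {r r′} (s : Short r) (s′ : Short r′) → label s ≡ label s′ → r ≡ r′
    label-injective (i , p , i< , p< , p↦) (i′ , p′ , i′< , p′< , p′↦) eq
      with i≡ , p≡ ← combine-injective (fromℕ< i<) (fromℕ< p<) (fromℕ< i′<) (fromℕ< p′<) eq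
      with refl ← fromℕ<-injective i i′ i< i′< i≡
         | refl ← code-injective {p} {p′} (fromℕ<-injective _ _ p< p′< p≡) =
      w-injective i (decode-injective (output-unique {p} {y = decode (c i)} p↦ p′↦))

    fewer : 2 ^ h * pred (2 ^ L) < 2 ^ (h + L)
    fewer = subst (2 ^ h * pred (2 ^ L) <_) (sym (^-distribˡ-+-* 2 h L))
      (*-monoʳ-< (2 ^ h) (≤-reflexive (suc-pred (2 ^ L))))

    absurd : ⊥
    absurd with r , r′ , r<r′ , eq ← pigeonhole fewer (λ r → label (short (toℕ<n r))) =
      <⇒≢ r<r′ (label-injective (short (toℕ<n r)) (short (toℕ<n r′)) eq)

  -- An empty program with output `x` is a prefix of the program for `true ∷ x`, hence equal to it,
  -- and would have two outputs.
  K₀-positive : ∀ x → 0 < K₀ K x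
  K₀-positive x with attained x [] | attained (true ∷ x) []
  ... | p , p↦ , length-p | q , q↦ , _ = n≢0⇒n>0 λ K≡0 →
    x≢true∷x (trivial {p} (trans length-p K≡0) p↦)
    where
    trivial : ∀ {p} → length p ≡ 0 → U ⟨ p ∣ [] ⟩↦ x → x ≡ true ∷ x
    trivial {[]} _ p↦ with refl ← prefixFree {[]} {[]} {q} {x} {true ∷ x} p↦ q↦ [] =
      output-unique {[]} {y = []} p↦ q↦

    x≢true∷x : x ≢ true ∷ x
    x≢true∷x eq = <⇒≢ (n<1+n (length x)) (cong length eq)

-- Comparison with ½

r+p<r+q⇒p<q : ∀ r {p q} → r ℚ.+ p ℚ.< r ℚ.+ q → p ℚ.< q
r+p<r+q⇒p<q r {p} {q} <′ = subst₂ ℚ._<_ (ℚ-group.\\-leftDividesʳ r p) (ℚ-group.\\-leftDividesʳ r q)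
  (ℚ.+-monoʳ-< (ℚ.- r) <′)

p≤∣p∣ : ∀ p → p ℚ.≤ ℚ.∣ p ∣
p≤∣p∣ p with ℚ.≤-total 0ℚ p
... | inj₁ 0≤p = ℚ.≤-reflexive (sym (ℚ.0≤p⇒∣p∣≡p 0≤p))
... | inj₂ p≤0 = ℚ.≤-trans p≤0 (ℚ.0≤∣p∣ p)

p<q⇒0<q-p : ∀ {p q} → p ℚ.< q → 0ℚ ℚ.< q ℚ.- p
p<q⇒0<q-p {p} {q} p<q = subst (ℚ._< q ℚ.- p) (ℚ.+-inverseʳ p) (ℚ.+-monoˡ-< (ℚ.- p) p<q)

eventually-< : ∀ {g ℓ q} → Converges g ℓ → ℓ ℚ.< q → ∃[ N ] (∀ {s} → N ≤ s → g s ℚ.< q)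
eventually-< {g} {ℓ} {q} g→ℓ ℓ<q with N , close ← g→ℓ (p<q⇒0<q-p ℓ<q) = N , λ {s} N≤s →
  r+p<r+q⇒p<q (ℚ.- ℓ) (subst₂ ℚ._<_ (ℚ.+-comm (g s) (ℚ.- ℓ)) (ℚ.+-comm q (ℚ.- ℓ))
    (ℚ.≤-<-trans (p≤∣p∣ (g s ℚ.- ℓ)) (close N≤s)))

eventually-> : ∀ {g ℓ q} → Converges g ℓ → q ℚ.< ℓ → ∃[ N ] (∀ {s} → N ≤ s → q ℚ.< g s)
eventually-> {g} {ℓ} {q} g→ℓ q<ℓ with N , close ← g→ℓ (p<q⇒0<q-p q<ℓ) = N , λ {s} N≤s →
  subst₂ ℚ._<_ (ℚ-group.⁻¹-involutive q) (ℚ-group.⁻¹-involutive (g s)) (ℚ.neg-antimono-< (r+p<r+q⇒p<q ℓ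
    (ℚ.≤-<-trans (p≤∣p∣ (ℓ ℚ.- g s)) (subst (ℚ._< ℓ ℚ.- q) (swap (g s)) (close N≤s)))))
  where
  swap : ∀ p → ℚ.∣ p ℚ.- ℓ ∣ ≡ ℚ.∣ ℓ ℚ.- p ∣
  swap p = trans (sym (ℚ.∣-p∣≡∣p∣ (p ℚ.- ℓ))) (cong ℚ.∣_∣ (ℚ-group.⁻¹-anti-homo-// p ℓ))

-- As `/` reduces its fraction, the comparison is made among unnormalised rationals.
/<½ : ∀ i d → i ℤ.* + 2 ℤ.< + suc d → i / suc d ℚ.< ½
/<½ i d i*2<d = ℚ.toℚᵘ-cancel-< (ℚᵘ.<-respˡ-≃ (ℚᵘ.≃-sym (ℚ.toℚᵘ-fromℚᵘ (mkℚᵘ i d)))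
  (*<* (subst (i ℤ.* + 2 ℤ.<_) (sym (ℤ.*-identityˡ (+ suc d))) i*2<d)))

/<½⁻¹ : ∀ i d → i / suc d ℚ.< ½ → i ℤ.* + 2 ℤ.< + suc d
/<½⁻¹ i d i/d<½ = subst (i ℤ.* + 2 ℤ.<_) (ℤ.*-identityˡ (+ suc d))
  (ℚᵘ.drop-*<* (ℚᵘ.<-respˡ-≃ (ℚ.toℚᵘ-fromℚᵘ (mkℚᵘ i d)) (ℚ.toℚᵘ-mono-< i/d<½)))

½</ : ∀ i d → + suc d ℤ.< i ℤ.* + 2 → ½ ℚ.< i / suc d
½</ i d d<i*2 = ℚ.toℚᵘ-cancel-< (ℚᵘ.<-respʳ-≃ (ℚᵘ.≃-sym (ℚ.toℚᵘ-fromℚᵘ (mkℚᵘ i d)))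
  (*<* (subst (ℤ._< i ℤ.* + 2) (sym (ℤ.*-identityˡ (+ suc d))) d<i*2)))

[a⊖b]*2 : ∀ a b → (a ℤ.⊖ b) ℤ.* + 2 ≡ + (2 * a) ℤ.- + (2 * b)
[a⊖b]*2 a b = trans (cong (ℤ._* + 2) (sym (ℤ.m-n≡m⊖n a b)))
  (trans (distrib (+ a) (+ b)) (cong₂ ℤ._-_ (sym (ℤ.pos-* 2 a)) (sym (ℤ.pos-* 2 b))))
  where
  distrib : ∀ i j → (i ℤ.- j) ℤ.* + 2 ≡ + 2 ℤ.* i ℤ.- + 2 ℤ.* j
  distrib = ℤ-solve-∀

-- For the representation used in `Computable`, comparison with `½` becomes an inequality of natural
-- numbers, which is a recursive predicate.
⊖/<½ : ∀ a b d → 2 * a < 2 * b + suc d → (a ℤ.⊖ b) / suc d ℚ.< ½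
⊖/<½ a b d 2a<2b+d = /<½ (a ℤ.⊖ b) d (subst₂ ℤ._<_ (sym ([a⊖b]*2 a b)) (cancel (+ (2 * b)) (+ suc d))
  (ℤ.+-monoˡ-< (ℤ.- + (2 * b)) (+<+ 2a<2b+d)))
  where
  cancel : ∀ i j → i ℤ.+ j ℤ.- i ≡ j
  cancel = ℤ-solve-∀

⊖/<½⁻¹ : ∀ a b d → (a ℤ.⊖ b) / suc d ℚ.< ½ → 2 * a < 2 * b + suc d
⊖/<½⁻¹ a b d <½ = ℤ.drop‿+<+ (subst (ℤ._< + (2 * b + suc d))
  (cancel (+ (2 * b)) (+ (2 * a)))
  (ℤ.+-monoʳ-< (+ (2 * b)) (subst (ℤ._< + suc d) ([a⊖b]*2 a b) (/<½⁻¹ (a ℤ.⊖ b) d <½))))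
  where
  cancel : ∀ i j → i ℤ.+ (j ℤ.- i) ≡ j
  cancel = ℤ-solve-∀

module _ {K : String → String → ℕ} (x y : String) where

  NID<½ : 2 * E K x y < K₀ K x ⊔ K₀ K y → NID K (x , y) ℚ.< ½
  NID<½ 2E<D with K₀ K x ⊔ K₀ K y
  ... | suc d = /<½ (+ E K x y) d (subst (ℤ._< + suc d) (trans (cong +_ (*-comm 2 (E K x y))) (ℤ.pos-* (E K x y) 2))
    (+<+ 2E<D))

  ½<NID : 0 < K₀ K x ⊔ K₀ K y → K₀ K x ⊔ K₀ K y < 2 * E K x y → ½ ℚ.< NID K (x , y)
  ½<NID 0<D D<2E with K₀ K x ⊔ K₀ K y
  ... | suc d = ½</ (+ E K x y) d (subst (+ suc d ℤ.<_) (trans (cong +_ (*-comm 2 (E K x y))) (ℤ.pos-* (E K x y) 2))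
    (+<+ D<2E))

-- A strict rise cannot end within the falling phase, so the rising phase has begun by stage `t`.
nondecreasing-after-rise : ∀ {g} → ΠShape 2 g → ∀ {s t} → s < t → g s ℚ.< g t →
                           ∀ {j} → t ≤ j → g t ℚ.≤ g j
nondecreasing-after-rise {g} (down-then S falling (up rising)) {s} {t} s<t gs<gt {j} t≤j with t <? S
... | yes t<S = 
  ⊥-elim (ℚ.<-irrefl refl (ℚ.<-≤-trans gs<gt (falling (<⇒≤ s<t) t<S)))
... | no  t≮S = subst₂ (λ a b → g a ℚ.≤ g b) (m+[n∸m]≡n S≤t) (m+[n∸m]≡n (≤-trans S≤t t≤j))
  (rising (∸-monoˡ-≤ S t≤j))
  where S≤t = ≮⇒≥ t≮S
-- Here the tail would have a shape of level 0.
nondecreasing-after-rise (down-then _ _ (up-then _ _ ()))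

-- Pairs at which the approximation rises too early

equivalentₚ : ∀ {n} {P Q : Vec ℕ n → Set} → (∀ ρ → P ρ → Q ρ) → (∀ ρ → Q ρ → P ρ) →
              RecursivePred P → RecursivePred Q
equivalentₚ to from P = record
  { char-rec = char-rec P
  ; sound    = λ ρ eq → to ρ (sound P ρ eq)
  ; complete = λ ρ q → complete P ρ (from ρ q)
  }

uniform : ∀ {P : ℕ → ℕ → Set} → (∀ {i t t′} → t ≤ t′ → P i t → P i t′) →
          ∀ n → (∀ i → i < n → ∃[ t ] P i t) → ∃[ t ] (∀ i → i < n → P i t)
uniform mono zero    each = 0 , λ _ ()
uniform {P} mono (suc n) each
  with t , p ← uniform {P} mono n (λ i i<n → each i (m<n⇒m<1+n i<n))
     | t′ , p′ ← each n (n<1+n n) = t ⊔ t′ , all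
  where
  all : ∀ i → i < suc n → P i (t ⊔ t′)
  all i i<1+n with i ≟ n
  ... | yes refl = mono (m≤n⊔m t t′) p′
  ... | no  i≢n  = mono (m≤m⊔n t t′) (p i (≤∧≢⇒< (s≤s⁻¹ i<1+n) i≢n))

module Contradiction
  {U : Machine} (universal : UniversalPrefixFree U)
  {K : String → String → ℕ} (complexity : IsComplexity U K)
  {f : Inputs → ℕ → ℚ} (computable : Computable f)
  (converges : ∀ z → Converges (f z) (NID K z)) (shape : ∀ z → ΠShape 2 (f z)) where

  open Bounds universal complexity

  Low : Vec ℕ 3 → Set
  Low (a ∷ b ∷ s ∷ []) = f (decode a , decode b) s ℚ.< ½

  Lowᵣ : RecursivePred Low
  Lowᵣ = equivalentₚ
    (λ { ρ@(_ ∷ _ ∷ _ ∷ []) lt →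
         subst (ℚ._< ½) (sym (value≡ ρ)) (⊖/<½ (pos ρ) (neg ρ) (denom ρ) lt) })
    (λ { ρ@(_ ∷ _ ∷ _ ∷ []) <½ →
         ⊖/<½⁻¹ (pos ρ) (neg ρ) (denom ρ) (subst (ℚ._< ½) (value≡ ρ) <½) })
    ((lit 2 *ᵣ posᵣ) <ₚ ((lit 2 *ᵣ negᵣ) +ᵣ sucᵣ denomᵣ))
    where
    num⁺ = proj₁ computable
    num⁻ = proj₁ (proj₂ computable)
    den  = proj₁ (proj₂ (proj₂ computable))

    value : Vec ℕ 3 → ℚ
    value (a ∷ b ∷ s ∷ []) = f (decode a , decode b) s

    eval : ∀ ρ → ∃[ p ] ∃[ n ] ∃[ d ] (num⁺ [ ρ ]⇓ p × num⁻ [ ρ ]⇓ n × den [ ρ ]⇓ d ×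
                                       value ρ ≡ (p ℤ.⊖ n) / suc d)
    eval (a ∷ b ∷ s ∷ []) =
      subst₂ (λ a′ b′ → let v = a′ ∷ b′ ∷ s ∷ [] in
                ∃[ p ] ∃[ n ] ∃[ d ] (num⁺ [ v ]⇓ p × num⁻ [ v ]⇓ n × den [ v ]⇓ d ×
                                      f (decode a , decode b) s ≡ (p ℤ.⊖ n) / suc d))
        (code-decode a) (code-decode b)
        (proj₂ (proj₂ (proj₂ computable)) (decode a) (decode b) s)

    pos neg denom : Vec ℕ 3 → ℕ
    pos ρ   = proj₁ (eval ρ)
    neg ρ   = proj₁ (proj₂ (eval ρ))
    denom ρ = proj₁ (proj₂ (proj₂ (eval ρ)))

    posᵣ : Recursive pos
    posᵣ = num⁺ , λ ρ → let _ , _ , _ , p⇓ , _ = eval ρ in p⇓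

    negᵣ : Recursive neg
    negᵣ = num⁻ , λ ρ → let _ , _ , _ , _ , n⇓ , _ = eval ρ in n⇓

    denomᵣ : Recursive denom
    denomᵣ = den , λ ρ → let _ , _ , _ , _ , _ , d⇓ , _ = eval ρ in d⇓

    value≡ : ∀ ρ → value ρ ≡ (pos ρ ℤ.⊖ neg ρ) / suc (denom ρ)
    value≡ ρ = let _ , _ , _ , _ , _ , _ , eq = eval ρ in eq

  -- `h k` is the least number above `2 * (2 * k)`, twice the final bound on `E`. `L k` is the least
  -- with `suc (m k) + 2 * k < 2 * L k`, which puts the bound on `K₀` below twice that on `E` in
  -- `risen`. `m k` is the number of bits that `κ-lower` requires for `h k` and `L k`.
  h L m : ℕ → ℕ
  h k = suc (4 * k)
  L k = 3 + 6 * k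
  m k = h k + L k

  hᵣ : ∀ {n} {k : Vec ℕ n → ℕ} → Recursive k → Recursive (λ ρ → h (k ρ))
  hᵣ k = sucᵣ (lit 4 *ᵣ k)

  mᵣ : ∀ {n} {k : Vec ℕ n → ℕ} → Recursive k → Recursive (λ ρ → m (k ρ))
  mᵣ k = hᵣ k +ᵣ sucᵣ (sucᵣ (sucᵣ (lit 6 *ᵣ k)))

  -- The header with its delimiter takes `k + 1` bits and the simulation `c` more, at most `2 * k`
  -- in all.
  overhead : ∀ {c k} → c < k → ∀ {l x} → x ≤ suc (k + l) + c → x ≤ l + 2 * k
  overhead {c} {k} c<k {l} x≤ = ≤-trans x≤ (≤-trans (≤-reflexive (sym (+-suc (k + l) c)))
    (≤-trans (+-monoʳ-≤ (k + l) c<k) (≤-reflexive (rearrange k l))))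
    where
    rearrange : ∀ k l → k + l + k ≡ l + 2 * k
    rearrange = solve-∀

  -- First search: a base where all values drop below ½

  upper-+ : ∃[ c ] (∀ k v b → v < 2 ^ m k → κ (b + v) b ≤ suc (k + m k) + c)
  upper-+ = κ-upper (var (# 2) +ᵣ var (# 1)) (mᵣ (var (# 0)))

  upper-∸ : ∃[ c ] (∀ k v b → v < 2 ^ m k → κ (b ∸ v) b ≤ suc (k + m k) + c)
  upper-∸ = κ-upper (var (# 2) ∸ᵣ var (# 1)) (mᵣ (var (# 0)))

  -- Bounding the stage by `t` makes this decidable, and monotone in `t`, so that finitely many
  -- pairs can share one `t`.
  Reached : ℕ → ℕ → ℕ → ℕ → Set
  Reached u i r t = ∃[ s ] (s < t × Low (u + i ∷ u + i + r ∷ s ∷ []))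

  AllReached : Vec ℕ 3 → Set
  AllReached ρ = let u = lookup ρ (# 0); t = lookup ρ (# 1); k = lookup ρ (# 2) in
    ∀ i → i < 2 ^ h k → ∀ r → r < 2 ^ m k → Reached u i r t

  AllReachedᵣ : RecursivePred AllReached
  AllReachedᵣ =
    ∀< (2^ᵣ hᵣ (var (# 2))) (∀< (2^ᵣ mᵣ (var (# 3))) (∃< (var (# 3)) (Lowᵣ ∘ₚ
      ((var (# 3) +ᵣ var (# 2)) ∷ᵣ ((var (# 3) +ᵣ var (# 2)) +ᵣ var (# 1)) ∷ᵣ var (# 0) ∷ᵣ []ᵣ))))

  k₁ : ℕ
  k₁ = suc (proj₁ upper-+ + proj₁ upper-∸)

  reached-later : ∀ u i r {t t′} → t ≤ t′ → Reached u i r t → Reached u i r t′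
  reached-later u i r t≤t′ (s , s<t , low) = s , <-≤-trans s<t t≤t′ , low

  -- The pairs are close to each other if all K(u + i) are large, as r can be described
  -- with m k bits.
  reached : ∀ k u i r → k₁ ≤ k → r < 2 ^ m k → 2 * (m k + 2 * k) < κ (u + i) 0 →
            ∃[ t ] Reached u i r t
  reached k u i r k₁≤k r< K-large = suc N , N , ≤-refl , below ≤-refl
    where
    K-+ : κ (u + i + r) (u + i) ≤ m k + 2 * k
    K-+ = overhead (≤-trans (s≤s (m≤m+n _ _)) k₁≤k) (proj₂ upper-+ k r (u + i) r<)

    K-∸ : κ (u + i) (u + i + r) ≤ m k + 2 * k
    K-∸ = overhead (≤-trans (s≤s (m≤n+m _ (proj₁ upper-+))) k₁≤k)
      (subst (λ a → κ a (u + i + r) ≤ suc (k + m k) + proj₁ upper-∸) (m+n∸n≡m (u + i) r)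
        (proj₂ upper-∸ k r (u + i + r) r<))

    close : ∃[ N ] (∀ {s} → N ≤ s → f (decode (u + i) , decode (u + i + r)) s ℚ.< ½)
    close = eventually-< (converges _) (NID<½ {K} (decode (u + i)) (decode (u + i + r))
      (≤-trans (s≤s (*-monoʳ-≤ 2 (⊔-lub K-∸ K-+))) (≤-trans K-large (m≤m⊔n _ _))))
    N = proj₁ close
    below = proj₂ close

  reached-exists : ∀ k → k₁ ≤ k → ∃[ u ] ∃[ t ] AllReached (u ∷ t ∷ k ∷ [])
  reached-exists k k₁≤k = u , uniform
    {λ i t → ∀ r → r < 2 ^ m k → Reached u i r t}
    (λ {i} t≤t′ p r r< → reached-later u i r t≤t′ (p r r<)) (2 ^ h k)
    λ i i< → uniform {Reached u i} (λ {r} → reached-later u i r) (2 ^ m k)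
      λ r r< → reached k u i r k₁≤k r< (proj₂ (proj₂ large) i<)
    where
    -- This makes `K₀` large at all shifts `u + i` at once; the condition 0 stands for the empty
    -- string.
    large = κ-lower (h k) (suc (2 * (m k + 2 * k))) (λ i u → u + i) (λ _ → 0)
              (λ i → +-cancelʳ-≡ i _ _)
    u = proj₁ large

  abstract
    -- Random numbers only show that a suitable `u` exists. The search replaces it by one computable
    -- from `k`, hence of small complexity.
    base : ∃[ f ] (Recursive f × (∀ k → k₁ ≤ k → ∃[ t ] AllReached (f (k ∷ []) ∷ t ∷ k ∷ [])))
    base = search² AllReachedᵣ k₁ reached-exists

  u : ℕ → ℕ
  u k = proj₁ base (k ∷ [])

  uᵣ : ∀ {n} {k : Vec ℕ n → ℕ} → Recursive k → Recursive (λ ρ → u (k ρ))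
  uᵣ k = proj₁ (proj₂ base) ∘ᵣ (k ∷ᵣ []ᵣ)

  -- Second search: an offset where all values return to ½

  upper-u : ∃[ c ] (∀ k v b → v < 2 ^ suc (m k) → κ (u k + v) b ≤ suc (k + suc (m k)) + c)
  upper-u = κ-upper (uᵣ (var (# 0)) +ᵣ var (# 1)) (sucᵣ (mᵣ (var (# 0))))

  -- A stage below `½` followed by one that is not: by `nondecreasing-after-rise`, the values can no
  -- longer fall below `½`.
  Risen : ℕ → ℕ → ℕ → Set
  Risen a b t = ∃[ s ] (s < t × ¬ Low (a ∷ b ∷ s ∷ []) × (∃[ s′ ] (s′ < s × Low (a ∷ b ∷ s′ ∷ []))))

  AllRisen : Vec ℕ 3 → Set
  AllRisen ρ = let r = lookup ρ (# 0); t = lookup ρ (# 1); k = lookup ρ (# 2) in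
    r < 2 ^ m k × (∀ i → i < 2 ^ h k → Risen (u k + i) (u k + i + r) t)

  AllRisenᵣ : RecursivePred AllRisen
  AllRisenᵣ = (var (# 0) <ₚ (2^ᵣ mᵣ (var (# 2)))) ×ₚ
    ∀< (2^ᵣ hᵣ (var (# 2))) (∃< (var (# 2)) ((¬ₚ (Lowᵣ ∘ₚ
      ((uᵣ (var (# 4)) +ᵣ var (# 1)) ∷ᵣ ((uᵣ (var (# 4)) +ᵣ var (# 1)) +ᵣ var (# 2)) ∷ᵣ
       var (# 0) ∷ᵣ []ᵣ))) ×ₚ
      ∃< (var (# 0)) (Lowᵣ ∘ₚ
      ((uᵣ (var (# 5)) +ᵣ var (# 2)) ∷ᵣ ((uᵣ (var (# 5)) +ᵣ var (# 2)) +ᵣ var (# 3)) ∷ᵣ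
       var (# 0) ∷ᵣ []ᵣ))))

  k₂ : ℕ
  k₂ = k₁ + suc (proj₁ upper-u)

  risen-later : ∀ a b {t t′} → t ≤ t′ → Risen a b t → Risen a b t′
  risen-later a b t≤t′ (s , s<t , rest) = s , <-≤-trans s<t t≤t′ , rest

  -- The pairs are far from each other if all K(u k + i + r ∣ u k + i) are large, since
  -- u k can now be computed from k.
  risen : ∀ k i r → k₂ ≤ k → i < 2 ^ h k → r < 2 ^ m k → L k ≤ κ (u k + i + r) (u k + i) →
          ∃[ t ] Risen (u k + i) (u k + i + r) t
  risen k i r k₂≤k i<2^h r< K-large =
    suc s , s , ≤-refl , (λ low → ℚ.<-asym low (above (m≤m⊔n N (suc s′)))) ,
    s′ , m≤n⊔m N (suc s′) , proj₂ (proj₂ was-reached)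
    where
    was-reached = proj₂ (proj₂ (proj₂ base) k (≤-trans (m≤m+n k₁ _) k₂≤k)) i i<2^h r r<
    s′ = proj₁ was-reached

    i<2^m : i < 2 ^ m k
    i<2^m = <-≤-trans i<2^h (^-monoʳ-≤ 2 (m≤m+n (h k) (L k)))

    -- Both `i` and `i + r` are below `2 ^ suc (m k)`, so one payload bit beyond `m k` covers both
    -- strings.
    K-u : ∀ {v} → v < 2 ^ suc (m k) → κ (u k + v) 0 ≤ suc (m k) + 2 * k
    K-u {v} v< = overhead (≤-trans (m≤n+m _ k₁) k₂≤k) (proj₂ upper-u k v 0 v<)

    K-x : κ (u k + i) 0 ≤ suc (m k) + 2 * k
    K-x = K-u (<-≤-trans i<2^m (m≤m+n (2 ^ m k) _))

    K-y : κ (u k + i + r) 0 ≤ suc (m k) + 2 * k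
    K-y = subst (λ a → κ a 0 ≤ suc (m k) + 2 * k) (sym (+-assoc (u k) i r))
      (K-u (subst (λ a → i + r < 2 ^ m k + a) (sym (+-identityʳ (2 ^ m k)))
        (+-mono-< i<2^m r<)))

    numeric : ∀ k → suc (suc (suc (4 * k) + (3 + 6 * k)) + 2 * k) ≡ 2 * (3 + 6 * k)
    numeric = solve-∀

    far : ∃[ N ] (∀ {s} → N ≤ s → ½ ℚ.< f (decode (u k + i) , decode (u k + i + r)) s)
    far = eventually-> (converges _) (½<NID {K} (decode (u k + i)) (decode (u k + i + r))
      (≤-trans (K₀-positive (decode (u k + i))) (m≤m⊔n _ _))
      (≤-trans (s≤s (⊔-lub K-x K-y)) (≤-trans (≤-reflexive (numeric k))
        (*-monoʳ-≤ 2 (≤-trans K-large (m≤n⊔m (κ (u k + i) (u k + i + r)) _))))))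
    N = proj₁ far
    above = proj₂ far
    s = N ⊔ suc s′

  risen-exists : ∀ k → k₂ ≤ k → ∃[ r ] ∃[ t ] AllRisen (r ∷ t ∷ k ∷ [])
  risen-exists k k₂≤k = r , proj₁ all , r< , proj₂ all
    where
    -- The condition `u k + i` varies with `i`, which `κ-lower` permits; its range for `r` is
    -- exactly `2 ^ m k`.
    large = κ-lower (h k) (L k) (λ i r → u k + i + r) (λ i → u k + i)
              (λ i → +-cancelˡ-≡ (u k + i) _ _)
    r  = proj₁ large
    r< = proj₁ (proj₂ large)
    all = uniform {λ i t → Risen (u k + i) (u k + i + r) t}
      (λ {i} → risen-later (u k + i) (u k + i + r)) (2 ^ h k)
      λ i i< → risen k i r k₂≤k i< r< (proj₂ (proj₂ large) i<)

  abstract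
    -- Again a computable choice replaces a random one. As the rise is required for all `i` at once,
    -- the offset does not depend on `i`, which stays free to be chosen at random afterwards.
    offset : ∃[ f ] (Recursive f × (∀ k → k₂ ≤ k → ∃[ t ] AllRisen (f (k ∷ []) ∷ t ∷ k ∷ [])))
    offset = search² AllRisenᵣ k₂ risen-exists

  -- A pair that must fall a second time

  d : ℕ → ℕ
  d k = proj₁ offset (k ∷ [])

  dᵣ : ∀ {n} {k : Vec ℕ n → ℕ} → Recursive k → Recursive (λ ρ → d (k ρ))
  dᵣ k = proj₁ (proj₂ offset) ∘ᵣ (k ∷ᵣ []ᵣ)

  -- The payload is empty: the header alone determines `d k`.
  upper-+d : ∃[ c ] (∀ k v b → v < 1 → κ (b + d k) b ≤ suc (k + 0) + c)
  upper-+d = κ-upper (var (# 2) +ᵣ dᵣ (var (# 0))) (lit 0)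

  upper-∸d : ∃[ c ] (∀ k v b → v < 1 → κ (b ∸ d k) b ≤ suc (k + 0) + c)
  upper-∸d = κ-upper (var (# 2) ∸ᵣ dᵣ (var (# 0))) (lit 0)

  k₃ : ℕ
  k₃ = k₂ + suc (proj₁ upper-+d + proj₁ upper-∸d)

  -- Since d k can be computed from k, the pairs are close again if K(u k + i) is large.
  no-V-shape : ⊥
  -- At stage `N ⊔ s` the value is below `½` but at least the value at `s`, so stage `s` would be
  -- low.
  no-V-shape = ¬low (ℚ.≤-<-trans
    (nondecreasing-after-rise (shape _) s′<s (ℚ.<-≤-trans low (ℚ.≮⇒≥ ¬low)) (m≤n⊔m N s))
    (below (m≤m⊔n N s)))
    where
    -- With a single index, `κ-lower` selects `i` itself below `2 ^ h k₃`, such that `K₀` at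
    -- `u k₃ + i` is at least `h k₃`.
    large = κ-lower 0 (h k₃) (λ _ i → u k₃ + i) (λ _ → 0) (λ _ → +-cancelˡ-≡ (u k₃) _ _)
    i = proj₁ large
    x = u k₃ + i
    y = x + d k₃

    was-risen : Risen x y _
    was-risen = proj₂ (proj₂ (proj₂ (proj₂ offset) k₃ (m≤m+n k₂ _))) i (proj₁ (proj₂ large))
    s    = proj₁ was-risen
    ¬low = proj₁ (proj₂ (proj₂ was-risen))
    s′<s = proj₁ (proj₂ (proj₂ (proj₂ (proj₂ was-risen))))
    low  = proj₂ (proj₂ (proj₂ (proj₂ (proj₂ was-risen))))

    K-+ : κ y x ≤ 2 * k₃
    K-+ = overhead (≤-trans (s≤s (m≤m+n _ _)) (m≤n+m _ k₂)) {0} (proj₂ upper-+d k₃ 0 x (s≤s z≤n))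

    K-∸ : κ x y ≤ 2 * k₃
    K-∸ = overhead (≤-trans (s≤s (m≤n+m _ (proj₁ upper-+d))) (m≤n+m _ k₂)) {0}
      (subst (λ a → κ a y ≤ suc (k₃ + 0) + proj₁ upper-∸d)
        (m+n∸n≡m x (d k₃)) (proj₂ upper-∸d k₃ 0 y (s≤s z≤n)))

    close : ∃[ N ] (∀ {s} → N ≤ s → f (decode x , decode y) s ℚ.< ½)
    close = eventually-< (converges _) (NID<½ {K} (decode x) (decode y)
      (≤-trans (s≤s (≤-trans (*-monoʳ-≤ 2 (⊔-lub K-∸ K-+)) (≤-reflexive (sym (*-assoc 2 2 k₃)))))
        (≤-trans (proj₂ (proj₂ large) (s≤s z≤n)) (m≤m⊔n _ _))))
    N = proj₁ close
    below = proj₂ close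

mainTheorem8 : (U : Machine) → UniversalPrefixFree U →
    (K : String → String → ℕ) → IsComplexity U K →
    ¬ (NID K ∈Π 2)
mainTheorem8 U universal K complexity (f , (computable , converges) , shape) =
  Contradiction.no-V-shape universal complexity computable converges shape
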